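{- The largest $N$ for which $t(N) \geq N/4$ can be demonstrated purely by rearranging powers of $2$ and $3$ in the standard factorization $N! = \prod\{1,\dots,N\}$ is $26244$; that is, $t_{2,3}(26244) \geq 26244/4$, and $t_{2,3}(N) < N/4$ for every $N > 26244$.
   Context: Call a natural number $3$-smooth if it is of the form $2^a3^b$ with integers $a,b\geq 0$, and $3$-rough if it is coprime to $6$. Each $n\in\{1,\dots,N\}$ factors uniquely as $n = d_n m_n$ with $d_n$ $3$-smooth and $m_n$ $3$-rough. Define $t_{2,3}(N)$ to be the largest $t$ for which there exist $3$-smooth natural numbers $\ell_1,\dots,\ell_N$ such that $\ell_1\cdots\ell_N$ divides $d_1\cdots d_N$ and $\ell_n m_n \geq t$ for all $1\le n\le N$ (i.e., the largest $t$ for which a $t$-admissible factorization or subfactorization of $N!$ into $N$ factors can be obtained from $\{1,\dots,N\}$ by rearranging only powers of $2$ and $3$). -}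

module Defs where

open import Data.Nat using (ℕ; zero; suc; _*_; _^_; _≤_; _≥_; _>_)
open import Data.Nat.Divisibility using (_∣_; _∣?_)
open import Data.Nat.DivMod using (_/_)
open import Data.Nat.Coprimality using (Coprime)
open import Data.Fin using (Fin; toℕ) renaming (zero to fzero; suc to fsuc)
open import Data.Product using (Σ; ∃; _×_)
open import Relation.Nullary using (¬_)
open import Relation.Nullary.Decidable using (does)
open import Data.Bool using (if_then_else_)
open import Relation.Binary.PropositionalEquality using (_≡_)

ThreeSmooth : ℕ → Set
ThreeSmooth d = ∃ λ a → ∃ λ b → d ≡ 2 ^ a * 3 ^ b

-- removing all factors 2 and 3 (fuel-bounded; fuel n suffices for n ≥ 1)
roughAux : ℕ → ℕ → ℕ
roughAux zero    n = n
roughAux (suc k) n =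
  if does (2 ∣? n) then roughAux k (n / 2)
  else if does (3 ∣? n) then roughAux k (n / 3)
  else n

roughPart : ℕ → ℕ
roughPart n = roughAux n n

smoothAux : ℕ → ℕ → ℕ
smoothAux zero    n = 1
smoothAux (suc k) n =
  if does (2 ∣? n) then 2 * smoothAux k (n / 2)
  else if does (3 ∣? n) then 3 * smoothAux k (n / 3)
  else 1

smoothPart : ℕ → ℕ
smoothPart n = smoothAux n n

-- product over the index set {1,…,N}, indexed by Fin N (index i ↦ n = i+1)
prodFin : ∀ {N} → (Fin N → ℕ) → ℕ
prodFin {zero}  f = 1
prodFin {suc N} f = f fzero * prodFin (λ i → f (fsuc i))

-- there exist 3-smooth ℓ_1..ℓ_N with ∏ ℓ ∣ ∏ d and 4·ℓ_n·m_n ≥ N for all n,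
-- i.e. t_{2,3}(N) ≥ N/4
QuarterAdmissible : ℕ → Set
QuarterAdmissible N =
  Σ (Fin N → ℕ) λ ℓ →
    (∀ i → ThreeSmooth (ℓ i)) ×
    (prodFin ℓ ∣ prodFin {N} (λ i → smoothPart (suc (toℕ i)))) ×
    (∀ i → 4 * (ℓ i * roughPart (suc (toℕ i))) ≥ N)

{-# OPTIONS --safe #-}
module Submission where

open import Defs
open import Data.Nat
open import Data.Nat.Properties
open import Data.Bool using (Bool; true; false; if_then_else_; not; T)
open import Data.Fin using (Fin; toℕ) renaming (zero to fzero; suc to fsuc)
open import Data.List using (List; []; _∷_; map; upTo; downFrom; filter; cartesianProductWith)
open import Data.List.Relation.Unary.All as All using (All; []; _∷_)
open import Data.List.Relation.Unary.AllPairs using ([]; _∷_)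
open import Data.List.Relation.Unary.All.Properties using (filter⁺; cartesianProductWith⁺)
open import Data.List.Relation.Unary.Unique.Propositional using (Unique)
open import Data.List.Relation.Unary.Unique.DecPropositional _≟_ using (unique?)
open import Data.Nat.DivMod
open import Data.Nat.Divisibility
open import Data.Nat.Primality using (Prime; euclidsLemma; prime?)
open import Data.Nat.Tactic.RingSolver using (solve-∀)
open import Data.Product using (_×_; _,_; proj₁; proj₂)
open import Data.Sum using (inj₁; inj₂; [_,_]′)
open import Function using (_∘_)
open import Relation.Binary.PropositionalEquality
open import Relation.Nullary using (¬_; yes; no; contradiction)
open import Relation.Nullary.Decidable using (does; dec-true; dec-false; toWitness; toWitnessFalse)

-- Give 2^a 3^b the cost 2a + 3b.  If ∏ ℓ_n ∣ ∏ d_n, the ℓ_n cost in total at most 2 ν₂(N!) + 3 ν₃(N!) ≤ 7N/2.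
-- Let M(c) be the largest 3-smooth number of cost at most c: if 4 ℓ_n m_n ≥ N, then ℓ_n costs at least the
-- number of c with 4 M(c) m_n < N.  Summed over the n = d m with d 3-smooth, d ≤ 10^6, and m 3-rough, this
-- bounds the total cost below by a combination of counts of 3-rough numbers, which grows as σN with σ slightly
-- above 7/2.  For N ≥ 3500000 a linear estimate of these counts yields a contradiction; for smaller N > 26244
-- the bounds, both monotone in N, are evaluated on a covering by intervals.  For N = 26244, a greedy choice
-- from a list of cheap 3-smooth numbers is an admissible ℓ.

private variable
  A B : Set

-- Sums over lists

∑ : List A → (A → ℕ) → ℕ
∑ []       f = 0
∑ (x ∷ xs) f = f x + ∑ xs f

infixr 5 ∑
syntax ∑ xs (λ x → e) = ∑[ x ← xs ] e

∑-map : ∀ (g : A → B) xs f → ∑ (map g xs) f ≡ ∑ xs (f ∘ g)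
∑-map g []       f = refl
∑-map g (x ∷ xs) f = cong (f (g x) +_) (∑-map g xs f)

∑-mono-All : ∀ {f g : A → ℕ} {xs} → All (λ x → f x ≤ g x) xs → ∑ xs f ≤ ∑ xs g
∑-mono-All []       = z≤n
∑-mono-All (p ∷ ps) = +-mono-≤ p (∑-mono-All ps)

∑-mono : ∀ {f g : A → ℕ} xs → (∀ x → f x ≤ g x) → ∑ xs f ≤ ∑ xs g
∑-mono xs f≤g = ∑-mono-All (All.universal f≤g xs)

∑-cong : ∀ {f g : A → ℕ} xs → (∀ x → f x ≡ g x) → ∑ xs f ≡ ∑ xs g
∑-cong []       f≡g = refl
∑-cong (x ∷ xs) f≡g = cong₂ _+_ (f≡g x) (∑-cong xs f≡g)

∑-+ : ∀ xs (f g : A → ℕ) → ∑ xs (λ x → f x + g x) ≡ ∑ xs f + ∑ xs g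
∑-+ []       f g = refl
∑-+ (x ∷ xs) f g = trans (cong (f x + g x +_) (∑-+ xs f g)) (interchange (f x) (g x) _ _)
  where
  interchange : ∀ a b c d → a + b + (c + d) ≡ a + c + (b + d)
  interchange = solve-∀

∑-*ˡ : ∀ xs k (f : A → ℕ) → ∑ xs (λ x → k * f x) ≡ k * ∑ xs f
∑-*ˡ []       k f = sym (*-zeroʳ k)
∑-*ˡ (x ∷ xs) k f = trans (cong (k * f x +_) (∑-*ˡ xs k f)) (sym (*-distribˡ-+ k (f x) _))

∑-*ʳ : ∀ xs k (f : A → ℕ) → ∑ xs (λ x → f x * k) ≡ ∑ xs f * k
∑-*ʳ xs k f = trans (∑-cong xs λ x → *-comm (f x) k) (trans (∑-*ˡ xs k f) (*-comm k _))

∑-0 : (xs : List A) → ∑ xs (λ _ → 0) ≡ 0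
∑-0 []       = refl
∑-0 (x ∷ xs) = ∑-0 xs

∑-comm : ∀ xs ys (f : A → B → ℕ) → ∑[ x ← xs ] ∑[ y ← ys ] f x y ≡ ∑[ y ← ys ] ∑[ x ← xs ] f x y
∑-comm []       ys f = sym (∑-0 ys)
∑-comm (x ∷ xs) ys f = trans (cong (∑ ys (f x) +_) (∑-comm xs ys f)) (sym (∑-+ ys (f x) _))

𝟙 : Bool → ℕ
𝟙 true  = 1
𝟙 false = 0

-- Applied with `e` the 3-smooth part of n, so that n is counted for at most one d of the list.
∑-𝟙-unique : ∀ {xs} e → Unique xs → ∑[ x ← xs ] 𝟙 (e ≡ᵇ x) ≤ 1
∑-𝟙-unique e []                  = z≤n
∑-𝟙-unique {x ∷ xs} e (x∉ ∷ u) with e ≡ᵇ x in eq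
... | false = ∑-𝟙-unique e u
... | true  = s≤s (≤-trans (∑-mono-All (All.map absent x∉)) (≤-reflexive (∑-0 xs)))
  where
  absent : ∀ {y} → x ≢ y → 𝟙 (e ≡ᵇ y) ≤ 0
  absent {y} x≢y with e ≡ᵇ y in eq′
  ... | false = z≤n
  ... | true  = contradiction
    (trans (sym (≡ᵇ⇒≡ e x (subst T (sym eq) _))) (≡ᵇ⇒≡ e y (subst T (sym eq′) _))) x≢y

-- Sums and products over 1, ..., N

range : ℕ → List ℕ
range N = map suc (downFrom N)

∑-range-mono : ∀ N {f g : ℕ → ℕ} → (∀ n → 1 ≤ n → n ≤ N → f n ≤ g n) → ∑ (range N) f ≤ ∑ (range N) g
∑-range-mono zero    f≤g = z≤n
∑-range-mono (suc N) f≤g = +-mono-≤ (f≤g (suc N) (s≤s z≤n) ≤-refl)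
  (∑-range-mono N λ n 1≤n n≤N → f≤g n 1≤n (m≤n⇒m≤1+n n≤N))

∑-range-extend : ∀ {M N} (f : ℕ → ℕ) → M ≤ N → ∑ (range M) f ≤ ∑ (range N) f
∑-range-extend {zero}            f _   = z≤n
∑-range-extend {suc M} {suc N}   f M≤N with m≤n⇒m<n∨m≡n M≤N
... | inj₁ (s≤s M<N) = m≤n⇒m≤o+n (f (suc N)) (∑-range-extend f M<N)
... | inj₂ refl      = ≤-refl

-- The numbers d, 2d, ..., Md are distinct members of 1, ..., dM; the terms between consecutive
-- multiples are dropped.
∑-range-multiples : ∀ d .{{_ : NonZero d}} M (f : ℕ → ℕ) →
  ∑[ m ← range M ] f (d * m) ≤ ∑ (range (d * M)) f
∑-range-multiples d         zero    f = z≤n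
∑-range-multiples d@(suc k) (suc M) f = begin
  f (d * suc M) + (∑[ m ← range M ] f (d * m))  ≤⟨ +-monoʳ-≤ (f (d * suc M)) (∑-range-multiples d M f) ⟩
  f (d * suc M) + ∑ (range (d * M)) f           ≡⟨ cong (λ n → f n + ∑ (range (d * M)) f) (*-suc d M) ⟩
  f (d + d * M) + ∑ (range (d * M)) f           ≤⟨ +-monoʳ-≤ (f (d + d * M)) (∑-range-extend f (m≤n+m (d * M) k)) ⟩
  ∑ (range (d + d * M)) f                       ≡⟨ cong (λ n → ∑ (range n) f) (*-suc d M) ⟨
  ∑ (range (d * suc M)) f                       ∎
  where open ≤-Reasoning

sumFin : ∀ {N} → (Fin N → ℕ) → ℕ
sumFin {zero}  f = 0
sumFin {suc N} f = f fzero + sumFin (f ∘ fsuc)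

sumFin-+ : ∀ {N} (f g : Fin N → ℕ) → sumFin (λ i → f i + g i) ≡ sumFin f + sumFin g
sumFin-+ {zero}  f g = refl
sumFin-+ {suc N} f g = trans (cong (f fzero + g fzero +_) (sumFin-+ (f ∘ fsuc) (g ∘ fsuc))) (interchange (f fzero) (g fzero) _ _)
  where
  interchange : ∀ a b c d → a + b + (c + d) ≡ a + c + (b + d)
  interchange = solve-∀

sumFin-*ˡ : ∀ {N} k (f : Fin N → ℕ) → sumFin (λ i → k * f i) ≡ k * sumFin f
sumFin-*ˡ {zero}  k f = sym (*-zeroʳ k)
sumFin-*ˡ {suc N} k f = trans (cong (k * f fzero +_) (sumFin-*ˡ k (f ∘ fsuc))) (sym (*-distribˡ-+ k (f fzero) _))

sumFin-mono : ∀ {N} {f g : Fin N → ℕ} → (∀ i → f i ≤ g i) → sumFin f ≤ sumFin g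
sumFin-mono {zero}  f≤g = z≤n
sumFin-mono {suc N} f≤g = +-mono-≤ (f≤g fzero) (sumFin-mono (f≤g ∘ fsuc))

-- `sumFin` recurses from the smallest index, whereas `range` lists N, ..., 1; splitting off the
-- term at 1 reconciles the two orders.
∑-range-uncons : ∀ N (f : ℕ → ℕ) → ∑ (range (suc N)) f ≡ f 1 + ∑ (range N) (f ∘ suc)
∑-range-uncons zero    f = refl
∑-range-uncons (suc N) f = trans (cong (f (2 + N) +_) (∑-range-uncons N f)) (swap (f (2 + N)) (f 1) _)
  where
  swap : ∀ a b c → a + (b + c) ≡ b + (a + c)
  swap = solve-∀

sumFin≡∑-range : ∀ N (f : ℕ → ℕ) → sumFin {N} (λ i → f (suc (toℕ i))) ≡ ∑ (range N) f
sumFin≡∑-range zero    f = refl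
sumFin≡∑-range (suc N) f = trans (cong (f 1 +_) (sumFin≡∑-range N (f ∘ suc))) (sym (∑-range-uncons N f))

prodFin-cong : ∀ {N} {f g : Fin N → ℕ} → (∀ i → f i ≡ g i) → prodFin f ≡ prodFin g
prodFin-cong {zero}  f≡g = refl
prodFin-cong {suc N} f≡g = cong₂ _*_ (f≡g fzero) (prodFin-cong (f≡g ∘ fsuc))

prodFin-smooth : ∀ {N} (a b : Fin N → ℕ) →
  prodFin (λ i → 2 ^ a i * 3 ^ b i) ≡ 2 ^ sumFin a * 3 ^ sumFin b
prodFin-smooth {zero}  a b = refl
prodFin-smooth {suc N} a b = begin
  2 ^ a fzero * 3 ^ b fzero * prodFin (λ i → 2 ^ a (fsuc i) * 3 ^ b (fsuc i))
    ≡⟨ cong (2 ^ a fzero * 3 ^ b fzero *_) (prodFin-smooth (a ∘ fsuc) (b ∘ fsuc)) ⟩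
  2 ^ a fzero * 3 ^ b fzero * (2 ^ sumFin (a ∘ fsuc) * 3 ^ sumFin (b ∘ fsuc))
    ≡⟨ [m*n]*[o*p]≡[m*o]*[n*p] (2 ^ a fzero) _ _ _ ⟩
  2 ^ a fzero * 2 ^ sumFin (a ∘ fsuc) * (3 ^ b fzero * 3 ^ sumFin (b ∘ fsuc))
    ≡⟨ cong₂ _*_ (^-distribˡ-+-* 2 (a fzero) _) (^-distribˡ-+-* 3 (b fzero) _) ⟨
  2 ^ sumFin a * 3 ^ sumFin b ∎
  where open ≡-Reasoning

-- Divisibility between 3-smooth numbers

∤^ : ∀ {p q} → Prime p → p ∤ q → ∀ n → p ∤ q ^ n
∤^ {p} pp p∤q zero    p∣1 with refl ← ∣1⇒≡1 p∣1 = p∤q (1∣ _)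
∤^ pp p∤q (suc n) p∣q^n = [ p∤q , ∤^ pp p∤q n ]′ (euclidsLemma _ _ pp p∣q^n)

-- Factors `p` are cancelled one at a time; were the right-hand power to run out first, `p` would
-- divide `c`.
^∣^*⇒≤ : ∀ {p c} .{{_ : NonZero p}} → p ∤ c → ∀ a a′ → p ^ a ∣ p ^ a′ * c → a ≤ a′
^∣^*⇒≤ p∤c zero    a′       _ = z≤n
^∣^*⇒≤ {p} p∤c (suc a) zero     d =
  contradiction (∣-trans (m∣m*n (p ^ a)) (subst (p ^ suc a ∣_) (*-identityˡ _) d)) p∤c
^∣^*⇒≤ {p} {c} p∤c (suc a) (suc a′) d =
  s≤s (^∣^*⇒≤ p∤c a a′ (*-cancelˡ-∣ p (subst (p ^ suc a ∣_) (*-assoc p (p ^ a′) c) d)))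

prime-2 : Prime 2
prime-2 = toWitness {a? = prime? 2} _

prime-3 : Prime 3
prime-3 = toWitness {a? = prime? 3} _

2∤3^ : ∀ b → 2 ∤ 3 ^ b
2∤3^ = ∤^ prime-2 λ d → contradiction (n∣m⇒m%n≡0 3 2 d) λ ()

3∤2^ : ∀ a → 3 ∤ 2 ^ a
3∤2^ = ∤^ prime-3 λ d → contradiction (n∣m⇒m%n≡0 2 3 d) λ ()

smooth-∣⇒≤ : ∀ a b a′ b′ → 2 ^ a * 3 ^ b ∣ 2 ^ a′ * 3 ^ b′ → a ≤ a′ × b ≤ b′
smooth-∣⇒≤ a b a′ b′ d =
  ^∣^*⇒≤ (2∤3^ b′) a a′ (∣-trans (m∣m*n (3 ^ b)) d) ,
  ^∣^*⇒≤ (3∤2^ a′) b b′ (subst (3 ^ b ∣_) (*-comm (2 ^ a′) (3 ^ b′)) (∣-trans (n∣m*n (2 ^ a)) d))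

-- The factorization n = d m with d 3-smooth and m 3-rough

twoAux : ℕ → ℕ → ℕ
twoAux zero    n = 0
twoAux (suc k) n =
  if does (2 ∣? n) then suc (twoAux k (n / 2))
  else if does (3 ∣? n) then twoAux k (n / 3)
  else 0

threeAux : ℕ → ℕ → ℕ
threeAux zero    n = 0
threeAux (suc k) n =
  if does (2 ∣? n) then threeAux k (n / 2)
  else if does (3 ∣? n) then suc (threeAux k (n / 3))
  else 0

ν₂ ν₃ : ℕ → ℕ
ν₂ n = twoAux n n
ν₃ n = threeAux n n

-- `twoAux` and `threeAux` branch on the same tests as `smoothAux`, so one case distinction unfolds
-- all three.
smoothAux≡ : ∀ k n → smoothAux k n ≡ 2 ^ twoAux k n * 3 ^ threeAux k n
smoothAux≡ zero    n = refl
smoothAux≡ (suc k) n with does (2 ∣? n)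
... | true  = trans (cong (2 *_) (smoothAux≡ k (n / 2))) (sym (*-assoc 2 (2 ^ twoAux k (n / 2)) _))
... | false with does (3 ∣? n)
...   | true  = trans (cong (3 *_) (smoothAux≡ k (n / 3))) (swap 3 (2 ^ twoAux k (n / 3)) _)
  where
  swap : ∀ a b c → a * (b * c) ≡ b * (a * c)
  swap = solve-∀
...   | false = refl

smoothPart≡ : ∀ n → smoothPart n ≡ 2 ^ ν₂ n * 3 ^ ν₃ n
smoothPart≡ n = smoothAux≡ n n

record Rough (m : ℕ) : Set where
  constructor rough
  field
    2∤m : 2 ∤ m
    3∤m : 3 ∤ m

-- The factor 1 is `2 ^ 0` evaluated, the shape that arises in `partsAux`.
2∤3^*rough : ∀ {m} → Rough m → ∀ b → 2 ∤ 1 * 3 ^ b * m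
2∤3^*rough (rough 2∤m _) b d =
  [ 2∤3^ b ∘ subst (2 ∣_) (*-identityˡ (3 ^ b)) , 2∤m ]′ (euclidsLemma (1 * 3 ^ b) _ prime-2 d)

record Factored (n : ℕ) : Set where
  constructor factored
  field
    a b m : ℕ
    m-rough : Rough m
    n≡ : n ≡ 2 ^ a * 3 ^ b * m

-- `k` bounds `n` and drops with each division, since the quotients are not structurally smaller.
factor : ∀ k n → 1 ≤ n → n ≤ k → Factored n
factor zero n 1≤n n≤0 = contradiction (≤-trans 1≤n n≤0) λ ()
factor (suc k) n 1≤n n≤k with 2 ∣? n
... | yes (divides-refl q) with factor k q 1≤q (≤-pred (≤-trans q<n n≤k))
  where
  1≤q : 1 ≤ q
  1≤q = n≢0⇒n>0 λ { refl → contradiction 1≤n λ () }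
  q<n : q < q * 2
  q<n = m<m*n q 2 {{>-nonZero 1≤q}} ≤-refl
...   | factored a b m r refl = factored (suc a) b m r (eq (2 ^ a) (3 ^ b) m)
  where
  eq : ∀ x y z → x * y * z * 2 ≡ 2 * x * y * z
  eq = solve-∀
factor (suc k) n 1≤n n≤k | no 2∤n with 3 ∣? n
... | yes (divides-refl q) with factor k q 1≤q (≤-pred (≤-trans q<n n≤k))
  where
  1≤q : 1 ≤ q
  1≤q = n≢0⇒n>0 λ { refl → contradiction 1≤n λ () }
  q<n : q < q * 3
  q<n = m<m*n q 3 {{>-nonZero 1≤q}} (s≤s (s≤s z≤n))
...   | factored a b m r refl = factored a (suc b) m r (eq (2 ^ a) (3 ^ b) m)
  where
  eq : ∀ x y z → x * y * z * 3 ≡ x * (3 * y) * z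
  eq = solve-∀
factor (suc k) n 1≤n n≤k | no 2∤n | no 3∤n =
  factored 0 0 n (rough 2∤n 3∤n) (sym (+-identityʳ n))

record Parts (k n a b m : ℕ) : Set where
  constructor parts
  field
    two   : twoAux k n ≡ a
    three : threeAux k n ≡ b
    rest  : roughAux k n ≡ m

if-true : ∀ {b} {x y : A} → b ≡ true → (if b then x else y) ≡ x
if-true refl = refl

if-false : ∀ {b} {x y z : A} → b ≡ false → y ≡ z → (if b then x else y) ≡ z
if-false refl eq = eq

module _ {k q a b m : ℕ} (P : Parts k q a b m) where
  open Parts P

  parts-double : Parts (suc k) (q * 2) (suc a) b m
  parts-double = parts
    (trans (if-true even) (cong suc (trans (cong (twoAux k) half) two)))
    (trans (if-true even) (trans (cong (threeAux k) half) three))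
    (trans (if-true even) (trans (cong (roughAux k) half) rest))
    where
    even : does (2 ∣? (q * 2)) ≡ true
    even = dec-true (2 ∣? (q * 2)) (divides q refl)
    half : q * 2 / 2 ≡ q
    half = m*n/n≡m q 2

  parts-triple : 2 ∤ q * 3 → Parts (suc k) (q * 3) a (suc b) m
  parts-triple 2∤ = parts
    (if-false odd (trans (if-true triple) (trans (cong (twoAux k) third) two)))
    (if-false odd (trans (if-true triple) (cong suc (trans (cong (threeAux k) third) three))))
    (if-false odd (trans (if-true triple) (trans (cong (roughAux k) third) rest)))
    where
    odd : does (2 ∣? (q * 3)) ≡ false
    odd = dec-false (2 ∣? (q * 3)) 2∤
    triple : does (3 ∣? (q * 3)) ≡ true
    triple = dec-true (3 ∣? (q * 3)) (divides q refl)
    third : q * 3 / 3 ≡ q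
    third = m*n/n≡m q 3

parts-rough : ∀ k {m} → Rough m → Parts k m 0 0 m
parts-rough zero    _ = parts refl refl refl
parts-rough (suc k) {m} (rough 2∤m 3∤m) = parts
  (if-false odd (if-false nontriple refl))
  (if-false odd (if-false nontriple refl))
  (if-false odd (if-false nontriple refl))
  where
  odd : does (2 ∣? m) ≡ false
  odd = dec-false (2 ∣? m) 2∤m
  nontriple : does (3 ∣? m) ≡ false
  nontriple = dec-false (3 ∣? m) 3∤m

-- Each factor 2 or 3 uses up one unit of fuel. A factor 3 is split off only once no factor 2 is
-- left, because the definitions test for 2 first.
partsAux : ∀ k a b {m} → Rough m → a + b ≤ k → Parts k (2 ^ a * 3 ^ b * m) a b m
partsAux k zero zero {m} r _ =
  subst (λ n → Parts k n 0 0 m) (sym (+-identityʳ m)) (parts-rough k r)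
partsAux (suc k) zero (suc b) {m} r (s≤s b≤k) =
  subst (λ n → Parts (suc k) n 0 (suc b) m) (eq (3 ^ b) m)
    (parts-triple (partsAux k 0 b r b≤k)
      (2∤3^*rough r (suc b) ∘ subst (2 ∣_) (eq (3 ^ b) m)))
  where
  eq : ∀ x y → 1 * x * y * 3 ≡ 1 * (3 * x) * y
  eq = solve-∀
partsAux (suc k) (suc a) b {m} r (s≤s a+b≤k) =
  subst (λ n → Parts (suc k) n (suc a) b m) (eq (2 ^ a) (3 ^ b) m)
    (parts-double (partsAux k a b r a+b≤k))
  where
  eq : ∀ x y z → x * y * z * 2 ≡ 2 * x * y * z
  eq = solve-∀

rough⇒nonZero : ∀ {m} → Rough m → NonZero m
rough⇒nonZero {zero}  (rough 2∤0 _) = contradiction (2 ∣0) 2∤0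
rough⇒nonZero {suc _} _             = _

n<p^n : ∀ p → 2 ≤ p → ∀ n → n < p ^ n
n<p^n p 2≤p zero    = s≤s z≤n
n<p^n p 2≤p (suc n) = begin-strict
  suc n          ≤⟨ n<p^n p 2≤p n ⟩
  p ^ n          <⟨ m<m*n (p ^ n) p {{>-nonZero (≤-<-trans z≤n (n<p^n p 2≤p n))}} 2≤p ⟩
  p ^ n * p      ≡⟨ *-comm (p ^ n) p ⟩
  p ^ suc n      ∎
  where open ≤-Reasoning

-- Shows that n = 2^a 3^b m is itself enough fuel, which is how `roughPart` and `smoothPart` use it.
exponents≤ : ∀ a b → a + b ≤ 2 ^ a * 3 ^ b
exponents≤ a b = begin
  a + b            ≤⟨ m≤m+n (a + b) (1 + a * b) ⟩
  a + b + (1 + a * b) ≡⟨ eq a b ⟩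
  suc a * suc b    ≤⟨ *-mono-≤ (n<p^n 2 ≤-refl a) (n<p^n 3 (s≤s (s≤s z≤n)) b) ⟩
  2 ^ a * 3 ^ b    ∎
  where
  open ≤-Reasoning
  eq : ∀ a b → a + b + (1 + a * b) ≡ suc a * suc b
  eq = solve-∀

module Factorization {a b m : ℕ} (r : Rough m) where
  private
    n : ℕ
    n = 2 ^ a * 3 ^ b * m
    P : Parts n n a b m
    P = partsAux n a b r (≤-trans (exponents≤ a b) (m≤m*n _ m {{rough⇒nonZero r}}))

  ν₂≡ : ν₂ n ≡ a
  ν₂≡ = Parts.two P

  ν₃≡ : ν₃ n ≡ b
  ν₃≡ = Parts.three P

  roughPart≡ : roughPart n ≡ m
  roughPart≡ = Parts.rest P

  smoothPart-≡ : smoothPart n ≡ 2 ^ a * 3 ^ b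
  smoothPart-≡ = trans (smoothPart≡ n) (cong₂ (λ x y → 2 ^ x * 3 ^ y) ν₂≡ ν₃≡)

factorization : ∀ n → 1 ≤ n → Factored n
factorization n 1≤n = factor n n 1≤n ≤-refl

ν₂-double : ∀ n → 1 ≤ n → ν₂ (2 * n) ≡ suc (ν₂ n)
ν₂-double n 1≤n with factored a b m r refl ← factorization n 1≤n =
  trans (cong ν₂ (eq (2 ^ a) (3 ^ b) m)) (trans (ν₂≡ {suc a} {b} r) (cong suc (sym (ν₂≡ {a} {b} r))))
  where
  open Factorization
  eq : ∀ x y z → 2 * (x * y * z) ≡ 2 * x * y * z
  eq = solve-∀

ν₂-odd : ∀ n → 1 ≤ n → 2 ∤ n → ν₂ n ≡ 0
ν₂-odd n 1≤n 2∤n with factorization n 1≤n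
... | factored zero    b m r refl = Factorization.ν₂≡ {0} {b} r
... | factored (suc a) b m r refl = contradiction (∣m⇒∣m*n m (∣m⇒∣m*n (3 ^ b) (m∣m*n (2 ^ a)))) 2∤n

ν₃-triple : ∀ n → 1 ≤ n → ν₃ (3 * n) ≡ suc (ν₃ n)
ν₃-triple n 1≤n with factored a b m r refl ← factorization n 1≤n =
  trans (cong ν₃ (eq (2 ^ a) (3 ^ b) m)) (trans (ν₃≡ {a} {suc b} r) (cong suc (sym (ν₃≡ {a} {b} r))))
  where
  open Factorization
  eq : ∀ x y z → 3 * (x * y * z) ≡ x * (3 * y) * z
  eq = solve-∀

ν₃-nontriple : ∀ n → 1 ≤ n → 3 ∤ n → ν₃ n ≡ 0
ν₃-nontriple n 1≤n 3∤n with factorization n 1≤n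
... | factored a zero    m r refl = Factorization.ν₃≡ {a} {0} r
... | factored a (suc b) m r refl = contradiction (∣m⇒∣m*n m (∣n⇒∣m*n (2 ^ a) (m∣m*n (3 ^ b)))) 3∤n

smoothPart-*-rough : ∀ {d m} → ThreeSmooth d → Rough m → smoothPart (d * m) ≡ d
smoothPart-*-rough (a , b , refl) r = Factorization.smoothPart-≡ {a} {b} r

roughPart-*-rough : ∀ {d m} → ThreeSmooth d → Rough m → roughPart (d * m) ≡ m
roughPart-*-rough (a , b , refl) r = Factorization.roughPart≡ {a} {b} r

-- Legendre's formula

n<[1+n/d]*d : ∀ n d .{{_ : NonZero d}} → n < suc (n / d) * d
n<[1+n/d]*d n d = begin-strict
  n                    ≡⟨ m≡m%n+[m/n]*n n d ⟩
  n % d + n / d * d    <⟨ +-monoˡ-< (n / d * d) (m%n<n n d) ⟩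
  suc (n / d) * d      ∎
  where open ≤-Reasoning

/-unique : ∀ {n q d} .{{_ : NonZero d}} → q * d ≤ n → n < suc q * d → n / d ≡ q
/-unique {n} {q} {d} qd≤n n<[1+q]d = ≤-antisym
  (≤-pred (m<n*o⇒m/o<n n<[1+q]d))
  (≤-trans (≤-reflexive (sym (m*n/n≡m q d))) (/-monoˡ-≤ d qd≤n))

-- Fuel f ≥ N suffices.
legendre : ∀ p .{{_ : NonZero p}} → ℕ → ℕ → ℕ
legendre p zero    N         = 0
legendre p (suc f) zero      = 0
legendre p (suc f) N@(suc _) = N / p + legendre p f (N / p)

module _ (p : ℕ) .{{_ : NonZero p}} (1<p : 1 < p) where

  private
    [1+n]/p≤n : ∀ n → suc n / p ≤ n
    [1+n]/p≤n n = ≤-pred (m/n<m (suc n) p 1<p)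

  module _ (ν : ℕ → ℕ)
    (ν-multiple : ∀ n → 1 ≤ n → ν (p * n) ≡ suc (ν n))
    (ν-nonmultiple : ∀ n → 1 ≤ n → p ∤ n → ν n ≡ 0) where

    -- Only the multiples p j with j ≤ N / p contribute, each with 1 + ν(j). In the induction on N,
    -- a nonmultiple leaves N / p unchanged and a multiple raises it by one.
    ∑-valuation-step : ∀ N → ∑ (range N) ν ≡ N / p + ∑ (range (N / p)) ν
    ∑-valuation-step zero = cong (λ q → q + ∑ (range q) ν) (sym (0/n≡0 p))
    ∑-valuation-step (suc N) with p ∣? suc N
    ... | no p∤1+N = begin
      ν (suc N) + ∑ (range N) ν            ≡⟨ cong (_+ ∑ (range N) ν) (ν-nonmultiple (suc N) (s≤s z≤n) p∤1+N) ⟩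
      ∑ (range N) ν                        ≡⟨ ∑-valuation-step N ⟩
      N / p + ∑ (range (N / p)) ν          ≡⟨ cong (λ q → q + ∑ (range q) ν) (sym same) ⟩
      suc N / p + ∑ (range (suc N / p)) ν  ∎
      where
      open ≡-Reasoning
      same : suc N / p ≡ N / p
      same = /-unique (m≤n⇒m≤1+n (m/n*n≤m N p))
        (≤∧≢⇒< (n<[1+n/d]*d N p) λ eq → p∤1+N (divides (suc (N / p)) eq))
    ... | yes (divides zero ())
    ... | yes (divides (suc q) eq) = begin
      ν (suc N) + ∑ (range N) ν            ≡⟨ cong₂ _+_ (trans (cong ν (trans eq (*-comm (suc q) p))) (ν-multiple (suc q) (s≤s z≤n))) (∑-valuation-step N) ⟩
      suc (ν (suc q)) + (N / p + ∑ (range (N / p)) ν)  ≡⟨ cong (λ x → suc (ν (suc q)) + (x + ∑ (range x) ν)) N/p≡q ⟩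
      suc (ν (suc q)) + (q + ∑ (range q) ν)  ≡⟨ shuffle (ν (suc q)) q _ ⟩
      suc q + ∑ (range (suc q)) ν          ≡⟨ cong (λ x → x + ∑ (range x) ν) (sym (trans (cong (_/ p) eq) (m*n/n≡m (suc q) p))) ⟩
      suc N / p + ∑ (range (suc N / p)) ν  ∎
      where
      open ≡-Reasoning
      N/p≡q : N / p ≡ q
      N/p≡q = /-unique
        (≤-pred (subst (suc (q * p) ≤_) (sym eq) (+-monoˡ-≤ (q * p) (≤-trans (s≤s z≤n) 1<p))))
        (≤-reflexive eq)
      shuffle : ∀ x y z → suc x + (y + z) ≡ suc y + (x + z)
      shuffle = solve-∀

    ∑-valuation : ∀ f N → N ≤ f → ∑ (range N) ν ≡ legendre p f N
    ∑-valuation zero    zero    _    = refl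
    ∑-valuation (suc f) zero    _    = refl
    ∑-valuation (suc f) (suc N) (s≤s N≤f) =
      trans (∑-valuation-step (suc N)) (cong (suc N / p +_) (∑-valuation f (suc N / p) (≤-trans ([1+n]/p≤n N) N≤f)))

-- This is ν_p(N!) ≤ N / (p - 1), with the base written `suc p` to avoid subtraction. For q = N / (p
-- + 1), induction bounds the later terms by q, and p q + q ≤ N.
legendre-bound : ∀ p .{{_ : NonZero (suc p)}} f N → p * legendre (suc p) f N ≤ N
legendre-bound p zero    N = ≤-trans (≤-reflexive (*-zeroʳ p)) z≤n
legendre-bound p (suc f) zero = ≤-reflexive (*-zeroʳ p)
legendre-bound p (suc f) N@(suc _) = begin
  p * (q + legendre (suc p) f q)      ≡⟨ *-distribˡ-+ p q _ ⟩
  p * q + p * legendre (suc p) f q    ≤⟨ +-monoʳ-≤ (p * q) (legendre-bound p f q) ⟩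
  p * q + q                           ≡⟨ eq p q ⟩
  q * suc p                           ≤⟨ m/n*n≤m N (suc p) ⟩
  N                                   ∎
  where
  open ≤-Reasoning
  q : ℕ
  q = N / suc p
  eq : ∀ p q → p * q + q ≡ q * suc p
  eq = solve-∀

-- Counting 3-rough numbers

roughᵇ : ℕ → Bool
roughᵇ 0 = false
roughᵇ 1 = true
roughᵇ 2 = false
roughᵇ 3 = false
roughᵇ 4 = false
roughᵇ 5 = true
roughᵇ (suc (suc (suc (suc (suc (suc n)))))) = roughᵇ n

roughᵇ⇒Rough : ∀ m → roughᵇ m ≡ true → Rough m
roughᵇ⇒Rough 1 _ = rough (toWitnessFalse {a? = 2 ∣? 1} _) (toWitnessFalse {a? = 3 ∣? 1} _)
roughᵇ⇒Rough 5 _ = rough (toWitnessFalse {a? = 2 ∣? 5} _) (toWitnessFalse {a? = 3 ∣? 5} _)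
roughᵇ⇒Rough (suc (suc (suc (suc (suc (suc n)))))) p with rough 2∤n 3∤n ← roughᵇ⇒Rough n p =
  rough (λ d → 2∤n (∣m+n∣m⇒∣n d (divides 3 refl))) (λ d → 3∤n (∣m+n∣m⇒∣n d (divides 2 refl)))

-- The two quotients count the numbers in 1, ..., x that are 1 and 5 modulo 6, respectively.
rough# : ℕ → ℕ
rough# x = (x + 5) / 6 + (x + 1) / 6

rough#-mono : ∀ {x y} → x ≤ y → rough# x ≤ rough# y
rough#-mono x≤y = +-mono-≤ (/-monoˡ-≤ 6 (+-monoˡ-≤ 5 x≤y)) (/-monoˡ-≤ 6 (+-monoˡ-≤ 1 x≤y))

rough#-count : ∀ x → rough# x ≡ ∑[ m ← range x ] 𝟙 (roughᵇ m)
rough#-count 0 = refl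
rough#-count 1 = refl
rough#-count 2 = refl
rough#-count 3 = refl
rough#-count 4 = refl
rough#-count 5 = refl
rough#-count (suc (suc (suc (suc (suc (suc x)))))) = begin
  rough# (6 + x)                             ≡⟨ cong₂ _+_ (m/n≡1+[m∸n]/n (m≤m+n 6 (x + 5))) (m/n≡1+[m∸n]/n (m≤m+n 6 (x + 1))) ⟩
  suc ((x + 5) / 6) + suc ((x + 1) / 6)      ≡⟨ cong suc (+-suc ((x + 5) / 6) _) ⟩
  2 + rough# x                               ≡⟨ cong (2 +_) (rough#-count x) ⟩
  2 + (∑[ m ← range x ] 𝟙 (roughᵇ m))        ≡⟨ window x ⟨
  ∑[ m ← range (6 + x) ] 𝟙 (roughᵇ m)        ∎
  where
  open ≡-Reasoning
  -- Six consecutive numbers contain exactly two 3-rough ones. The term for 6 + x has already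
  -- reduced to `roughᵇ x`.
  window : ∀ x {s} → 𝟙 (roughᵇ x) + (𝟙 (roughᵇ (5 + x)) + (𝟙 (roughᵇ (4 + x)) + (𝟙 (roughᵇ (3 + x))
    + (𝟙 (roughᵇ (2 + x)) + (𝟙 (roughᵇ (1 + x)) + s))))) ≡ 2 + s
  window 0 = refl
  window 1 = refl
  window 2 = refl
  window 3 = refl
  window 4 = refl
  window 5 = refl
  window (suc (suc (suc (suc (suc (suc x)))))) = window x

-- Each of the two quotients loses at most 5/6 to rounding, so the count is at least (2x - 4) / 6.
rough#-linear : ∀ x → x ≤ 3 * rough# x + 2
rough#-linear x = *-cancelˡ-≤ 2 (+-cancelʳ-≤ 6 _ _ (begin
  2 * x + 6                                     ≡⟨ eq₁ x ⟩
  (x + 5) + (x + 1)                             ≤⟨ +-mono-≤ (≤-pred (n<[1+n/d]*d (x + 5) 6)) (≤-pred (n<[1+n/d]*d (x + 1) 6)) ⟩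
  5 + (x + 5) / 6 * 6 + (5 + (x + 1) / 6 * 6)   ≡⟨ eq₂ ((x + 5) / 6) ((x + 1) / 6) ⟩
  2 * (3 * rough# x + 2) + 6                    ∎))
  where
  open ≤-Reasoning
  eq₁ : ∀ x → 2 * x + 6 ≡ (x + 5) + (x + 1)
  eq₁ = solve-∀
  eq₂ : ∀ u v → 5 + u * 6 + (5 + v * 6) ≡ 2 * (3 * (u + v) + 2) + 6
  eq₂ = solve-∀

-- Division by zero yields 0.
_quot_ : ℕ → ℕ → ℕ
n quot zero      = 0
n quot d@(suc _) = n / d

quot-mono : ∀ {m n} d → m ≤ n → m quot d ≤ n quot d
quot-mono zero      _   = z≤n
quot-mono d@(suc _) m≤n = /-monoˡ-≤ d m≤n

*-quot-≤ : ∀ n d → d * (n quot d) ≤ n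
*-quot-≤ n zero      = z≤n
*-quot-≤ n d@(suc _) = ≤-trans (≤-reflexive (*-comm d (n / d))) (m/n*n≤m n d)

-- Costs of 3-smooth numbers

cost : ℕ → ℕ → ℕ
cost a b = 2 * a + 3 * b

-- The largest 2^a 3^b of cost at most c.
maxSmooth : ℕ → ℕ
maxSmooth 0 = 1
maxSmooth 1 = 1
maxSmooth 2 = 2
maxSmooth 3 = 3
maxSmooth 4 = 4
maxSmooth (suc (suc (suc c@(suc (suc _))))) = 3 * maxSmooth c

-- From c = 5 on, both sides are three times their values at c - 3, so the first five cases imply
-- the rest.
maxSmooth-suc : ∀ c → maxSmooth c ≤ maxSmooth (1 + c)
maxSmooth-suc 0 = ≤ᵇ⇒≤ _ _ _
maxSmooth-suc 1 = ≤ᵇ⇒≤ _ _ _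
maxSmooth-suc 2 = ≤ᵇ⇒≤ _ _ _
maxSmooth-suc 3 = ≤ᵇ⇒≤ _ _ _
maxSmooth-suc 4 = ≤ᵇ⇒≤ _ _ _
maxSmooth-suc (suc (suc (suc c@(suc (suc _))))) = *-monoʳ-≤ 3 (maxSmooth-suc c)

maxSmooth-double : ∀ c → 2 * maxSmooth c ≤ maxSmooth (2 + c)
maxSmooth-double 0 = ≤ᵇ⇒≤ _ _ _
maxSmooth-double 1 = ≤ᵇ⇒≤ _ _ _
maxSmooth-double 2 = ≤ᵇ⇒≤ _ _ _
maxSmooth-double 3 = ≤ᵇ⇒≤ _ _ _
maxSmooth-double 4 = ≤ᵇ⇒≤ _ _ _
maxSmooth-double (suc (suc (suc c@(suc (suc _))))) =
  ≤-trans (≤-reflexive (swap (maxSmooth c))) (*-monoʳ-≤ 3 (maxSmooth-double c))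
  where
  swap : ∀ x → 2 * (3 * x) ≡ 3 * (2 * x)
  swap = solve-∀

maxSmooth-triple : ∀ c → 3 * maxSmooth c ≤ maxSmooth (3 + c)
maxSmooth-triple 0 = ≤ᵇ⇒≤ _ _ _
maxSmooth-triple 1 = ≤ᵇ⇒≤ _ _ _
maxSmooth-triple (suc (suc _)) = ≤-refl

maxSmooth-mono : ∀ {c c′} → c ≤ c′ → maxSmooth c ≤ maxSmooth c′
maxSmooth-mono {c} {zero}   z≤n = ≤-refl
maxSmooth-mono {c} {suc c′} c≤ with m≤n⇒m<n∨m≡n c≤
... | inj₁ (s≤s c≤c′) = ≤-trans (maxSmooth-mono c≤c′) (maxSmooth-suc c′)
... | inj₂ refl       = ≤-refl

-- A further factor 2 or 3 raises the cost by 2 or 3, and `maxSmooth` then grows by at least that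
-- factor.
smooth≤maxSmooth : ∀ a b → 2 ^ a * 3 ^ b ≤ maxSmooth (cost a b)
smooth≤maxSmooth zero    zero    = ≤-refl
smooth≤maxSmooth zero    (suc b) = begin
  1 * (3 * 3 ^ b)            ≡⟨ eq₁ (3 ^ b) ⟩
  3 * (1 * 3 ^ b)            ≤⟨ *-monoʳ-≤ 3 (smooth≤maxSmooth zero b) ⟩
  3 * maxSmooth (3 * b)      ≤⟨ maxSmooth-triple (3 * b) ⟩
  maxSmooth (3 + 3 * b)      ≡⟨ cong maxSmooth (*-suc 3 b) ⟨
  maxSmooth (3 * suc b)      ∎
  where
  open ≤-Reasoning
  eq₁ : ∀ x → 1 * (3 * x) ≡ 3 * (1 * x)
  eq₁ = solve-∀
smooth≤maxSmooth (suc a) b       = begin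
  2 * 2 ^ a * 3 ^ b          ≡⟨ *-assoc 2 (2 ^ a) (3 ^ b) ⟩
  2 * (2 ^ a * 3 ^ b)        ≤⟨ *-monoʳ-≤ 2 (smooth≤maxSmooth a b) ⟩
  2 * maxSmooth (cost a b)   ≤⟨ maxSmooth-double (cost a b) ⟩
  maxSmooth (2 + cost a b)   ≡⟨ cong (λ c → maxSmooth (c + 3 * b)) (*-suc 2 a) ⟨
  maxSmooth (cost (suc a) b) ∎
  where open ≤-Reasoning

-- Demand and supply of cost

jumps : ℕ → List ℕ
jumps C = map (λ c → 4 * maxSmooth c) (downFrom C)

-- For `qs = jumps C` this counts the c < C that are too small for m: no 3-smooth ℓ of cost at most
-- c has 4 ℓ m ≥ N.
demand : List ℕ → ℕ → ℕ → ℕ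
demand qs N m = ∑[ q ← qs ] 𝟙 (q * m <ᵇ N)

-- The induction carries the bound by C along: if `p C` holds, at most C earlier numbers are
-- counted, and C < κ.
∑-downFrom-𝟙 : ∀ C κ {p : ℕ → Bool} → (∀ c → p c ≡ true → c < κ) → ∑[ c ← downFrom C ] 𝟙 (p c) ≤ κ
∑-downFrom-𝟙 C κ {p} p⇒<κ = ≤-trans (both C) (m⊓n≤n C κ)
  where
  both : ∀ C → ∑[ c ← downFrom C ] 𝟙 (p c) ≤ C ⊓ κ
  both zero    = z≤n
  both (suc C) with p C in eq
  ... | false = ≤-trans (both C) (⊓-monoˡ-≤ κ (n≤1+n C))
  ... | true  = ⊓-glb (s≤s (≤-trans (both C) (m⊓n≤m C κ)))
                      (≤-trans (s≤s (≤-trans (both C) (m⊓n≤m C κ))) (p⇒<κ C eq))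

-- Were the cost at most a counted c, then 2^a 3^b ≤ M(c), and 4 M(c) m < N would contradict the
-- hypothesis. So every counted c lies below the cost.
demand≤cost : ∀ C N a b m → N ≤ 4 * (2 ^ a * 3 ^ b * m) → demand (jumps C) N m ≤ cost a b
demand≤cost C N a b m N≤ = ≤-trans
  (≤-reflexive (∑-map (λ c → 4 * maxSmooth c) (downFrom C) _))
  (∑-downFrom-𝟙 C (cost a b) below)
  where
  open ≤-Reasoning
  below : ∀ c → (4 * maxSmooth c * m <ᵇ N) ≡ true → c < cost a b
  below c eq = ≰⇒> λ κ≤c → <-irrefl refl (begin-strict
    4 * maxSmooth c * m      <⟨ <ᵇ⇒< _ N (subst T (sym eq) _) ⟩
    N                        ≤⟨ N≤ ⟩
    4 * (2 ^ a * 3 ^ b * m)  ≤⟨ *-monoʳ-≤ 4 (*-monoˡ-≤ m (≤-trans (smooth≤maxSmooth a b) (maxSmooth-mono κ≤c))) ⟩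
    4 * (maxSmooth c * m)    ≡⟨ *-assoc 4 (maxSmooth c) m ⟨
    4 * maxSmooth c * m      ∎)

-- The cost of d_1 ⋯ d_N, that is, 2 ν₂(N!) + 3 ν₃(N!).
supply : ℕ → ℕ
supply N = 2 * legendre 2 N N + 3 * legendre 3 N N

∑-ν₂ : ∀ N → ∑ (range N) ν₂ ≡ legendre 2 N N
∑-ν₂ N = ∑-valuation 2 (s≤s (s≤s z≤n)) ν₂ ν₂-double ν₂-odd N N ≤-refl

∑-ν₃ : ∀ N → ∑ (range N) ν₃ ≡ legendre 3 N N
∑-ν₃ N = ∑-valuation 3 (s≤s (s≤s z≤n)) ν₃ ν₃-triple ν₃-nontriple N N ≤-refl

-- Passing to the sums of valuations makes this clear, whereas the fuel of `legendre` changes with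
-- N.
supply-mono : ∀ {M N} → M ≤ N → supply M ≤ supply N
supply-mono {M} {N} M≤N = +-mono-≤
  (*-monoʳ-≤ 2 (subst₂ _≤_ (∑-ν₂ M) (∑-ν₂ N) (∑-range-extend ν₂ M≤N)))
  (*-monoʳ-≤ 3 (subst₂ _≤_ (∑-ν₃ M) (∑-ν₃ N) (∑-range-extend ν₃ M≤N)))

supply-bound : ∀ N → 2 * supply N ≤ 7 * N
supply-bound N = begin
  2 * (2 * l₂ + 3 * l₃)      ≡⟨ eq₁ l₂ l₃ ⟩
  4 * (1 * l₂) + 3 * (2 * l₃) ≤⟨ +-mono-≤ (*-monoʳ-≤ 4 (legendre-bound 1 N N)) (*-monoʳ-≤ 3 (legendre-bound 2 N N)) ⟩
  4 * N + 3 * N              ≡⟨ *-distribʳ-+ N 4 3 ⟨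
  7 * N                      ∎
  where
  open ≤-Reasoning
  l₂ l₃ : ℕ
  l₂ = legendre 2 N N
  l₃ = legendre 3 N N
  eq₁ : ∀ x y → 2 * (2 * x + 3 * y) ≡ 4 * (1 * x) + 3 * (2 * y)
  eq₁ = solve-∀

-- Cost is additive in the exponents, and the divisibility of the products bounds the sum of
-- exponents of 2 and that of 3 separately.
demand≤supply : ∀ C N → QuarterAdmissible N → ∑[ n ← range N ] demand (jumps C) N (roughPart n) ≤ supply N
demand≤supply C N (ℓ , ℓ-smooth , ∏ℓ∣∏d , ℓ-large) = begin
  ∑[ n ← range N ] demand (jumps C) N (roughPart n)
    ≡⟨ sumFin≡∑-range N _ ⟨
  sumFin {N} (λ i → demand (jumps C) N (roughPart (suc (toℕ i))))
    ≤⟨ sumFin-mono (λ i → demand≤cost C N (a i) (b i) (roughPart (suc (toℕ i)))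
        (subst (λ l → N ≤ 4 * (l * roughPart (suc (toℕ i)))) (ℓ≡ i) (ℓ-large i))) ⟩
  sumFin (λ i → cost (a i) (b i))
    ≡⟨ trans (sumFin-+ (λ i → 2 * a i) (λ i → 3 * b i)) (cong₂ _+_ (sumFin-*ˡ 2 a) (sumFin-*ˡ 3 b)) ⟩
  cost (sumFin a) (sumFin b)
    ≤⟨ +-mono-≤ (*-monoʳ-≤ 2 (proj₁ sums≤)) (*-monoʳ-≤ 3 (proj₂ sums≤)) ⟩
  cost (sumFin {N} a′) (sumFin {N} b′)
    ≡⟨ cong₂ cost (trans (sumFin≡∑-range N ν₂) (∑-ν₂ N)) (trans (sumFin≡∑-range N ν₃) (∑-ν₃ N)) ⟩
  supply N ∎
  where
  open ≤-Reasoning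
  a b a′ b′ : Fin N → ℕ
  a i = proj₁ (ℓ-smooth i)
  b i = proj₁ (proj₂ (ℓ-smooth i))
  a′ i = ν₂ (suc (toℕ i))
  b′ i = ν₃ (suc (toℕ i))
  ℓ≡ : ∀ i → ℓ i ≡ 2 ^ a i * 3 ^ b i
  ℓ≡ i = proj₂ (proj₂ (ℓ-smooth i))
  sums≤ : sumFin a ≤ sumFin a′ × sumFin b ≤ sumFin b′
  sums≤ = smooth-∣⇒≤ _ _ _ _ (subst₂ _∣_
    (trans (prodFin-cong ℓ≡) (prodFin-smooth a b))
    (trans (prodFin-cong {N} (λ i → smoothPart≡ (suc (toℕ i)))) (prodFin-smooth a′ b′))
    ∏ℓ∣∏d)

-- A lower bound for the total demand

term : ℕ → ℕ × ℕ → ℕ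
term N (w , k) = w * rough# (N quot k)

-- The two lists of pairs (weight , divisor) are arguments so that evaluation shares them between calls.
weighted : List (ℕ × ℕ) → List (ℕ × ℕ) → ℕ → ℕ
weighted ds qs N = ∑ ds (term N) + ∑ qs (term (N ∸ 1))

module LowerBound (L qs : List ℕ) where

  -- A pair (d, q) contributes the 3-rough m with d m ≤ N and q m < N. The first condition implies
  -- the second if q < d, and the second implies the first otherwise. Grouping the pairs by the
  -- decisive condition turns the double sum into two single ones.
  smoothWeights jumpWeights : List (ℕ × ℕ)
  smoothWeights = map (λ d → ∑[ q ← qs ] 𝟙 (q <ᵇ d) , d) L
  jumpWeights   = map (λ q → ∑[ d ← L ] 𝟙 (not (q <ᵇ d)) , q) qs

  lower : ℕ → ℕ
  lower = weighted smoothWeights jumpWeights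

  term-mono : ∀ {M N} k → M ≤ N → term M k ≤ term N k
  term-mono (w , k) M≤N = *-monoʳ-≤ w (rough#-mono (quot-mono k M≤N))

  lower-mono : ∀ {M N} → M ≤ N → lower M ≤ lower N
  lower-mono {M} {N} M≤N = +-mono-≤
    (∑-mono smoothWeights λ k → term-mono k M≤N)
    (∑-mono jumpWeights λ k → term-mono k (∸-monoˡ-≤ 1 M≤N))

  -- The strict q m < N amounts to q m ≤ N - 1, hence `N ∸ 1`.
  pair : ℕ → ℕ → ℕ → ℕ
  pair N d q = if q <ᵇ d then rough# (N quot d) else rough# ((N ∸ 1) quot q)

  -- Undoes the grouping: each weight is expanded into the indicators that it counts.
  lower≡ : ∀ N → lower N ≡ ∑[ d ← L ] ∑[ q ← qs ] pair N d q
  lower≡ N = begin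
    lower N
      ≡⟨ cong₂ _+_ (∑-map _ L (term N)) (∑-map _ qs (term (N ∸ 1))) ⟩
    (∑[ d ← L ] (∑[ q ← qs ] 𝟙 (q <ᵇ d)) * u d) + (∑[ q ← qs ] (∑[ d ← L ] 𝟙 (not (q <ᵇ d))) * v q)
      ≡⟨ cong₂ _+_ (∑-cong L λ d → sym (∑-*ʳ qs (u d) _)) (∑-cong qs λ q → sym (∑-*ʳ L (v q) _)) ⟩
    (∑[ d ← L ] ∑[ q ← qs ] 𝟙 (q <ᵇ d) * u d) + (∑[ q ← qs ] ∑[ d ← L ] 𝟙 (not (q <ᵇ d)) * v q)
      ≡⟨ cong ((∑[ d ← L ] ∑[ q ← qs ] 𝟙 (q <ᵇ d) * u d) +_) (∑-comm qs L _) ⟩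
    (∑[ d ← L ] ∑[ q ← qs ] 𝟙 (q <ᵇ d) * u d) + (∑[ d ← L ] ∑[ q ← qs ] 𝟙 (not (q <ᵇ d)) * v q)
      ≡⟨ ∑-+ L _ _ ⟨
    ∑[ d ← L ] ((∑[ q ← qs ] 𝟙 (q <ᵇ d) * u d) + (∑[ q ← qs ] 𝟙 (not (q <ᵇ d)) * v q))
      ≡⟨ ∑-cong L (λ d → trans (sym (∑-+ qs _ _)) (∑-cong qs λ q → split (q <ᵇ d) (u d) (v q))) ⟩
    ∑[ d ← L ] ∑[ q ← qs ] pair N d q ∎
    where
    open ≡-Reasoning
    u v : ℕ → ℕ
    u d = rough# (N quot d)
    v q = rough# ((N ∸ 1) quot q)
    split : ∀ c x y → 𝟙 c * x + 𝟙 (not c) * y ≡ (if c then x else y)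
    split true  x y = trans (+-identityʳ (x + 0)) (+-identityʳ x)
    split false x y = +-identityʳ y

  module _ {N : ℕ} (1≤N : 1 ≤ N) where

    private
      N∸1<N : N ∸ 1 < N
      N∸1<N = ∸-monoʳ-< {o = 0} (s≤s z≤n) 1≤N

    rough#≤ : ∀ {X Y q} → Y ≤ X → (∀ m → 1 ≤ m → m ≤ Y → q * m < N) →
      rough# Y ≤ ∑[ m ← range X ] 𝟙 (roughᵇ m) * 𝟙 (q * m <ᵇ N)
    rough#≤ {X} {Y} {q} Y≤X below = begin
      rough# Y                                            ≡⟨ rough#-count Y ⟩
      ∑[ m ← range Y ] 𝟙 (roughᵇ m)                       ≤⟨ ∑-range-mono Y (λ m 1≤m m≤Y → ≤-reflexive (sym (counted m (below m 1≤m m≤Y)))) ⟩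
      ∑[ m ← range Y ] 𝟙 (roughᵇ m) * 𝟙 (q * m <ᵇ N)      ≤⟨ ∑-range-extend _ Y≤X ⟩
      ∑[ m ← range X ] 𝟙 (roughᵇ m) * 𝟙 (q * m <ᵇ N)      ∎
      where
      open ≤-Reasoning
      counted : ∀ m → q * m < N → 𝟙 (roughᵇ m) * 𝟙 (q * m <ᵇ N) ≡ 𝟙 (roughᵇ m)
      counted m qm<N with q * m <ᵇ N | <⇒<ᵇ qm<N
      ... | true | _ = *-identityʳ _

    pair≤ : ∀ d q → 1 ≤ d →
      pair N d q ≤ ∑[ m ← range (N quot d) ] 𝟙 (roughᵇ m) * 𝟙 (q * m <ᵇ N)
    pair≤ d@(suc _) q _ with q <ᵇ d in eq
    ... | true  = rough#≤ {q = q} ≤-refl λ m 1≤m m≤ → begin-strict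
      q * m               <⟨ *-monoˡ-< m {{>-nonZero 1≤m}} (<ᵇ⇒< q d (subst T (sym eq) _)) ⟩
      d * m               ≤⟨ *-monoʳ-≤ d m≤ ⟩
      d * (N quot d)      ≤⟨ *-quot-≤ N d ⟩
      N                   ∎
      where open ≤-Reasoning
    ... | false = rough#≤ {q = q} (quot≤ d≤q) λ m _ m≤ → begin-strict
      q * m                   ≤⟨ *-monoʳ-≤ q m≤ ⟩
      q * ((N ∸ 1) quot q)    ≤⟨ *-quot-≤ (N ∸ 1) q ⟩
      N ∸ 1                   <⟨ N∸1<N ⟩
      N                       ∎
      where
      open ≤-Reasoning
      d≤q : d ≤ q
      d≤q = ≮⇒≥ λ q<d → subst T eq (<⇒<ᵇ q<d)
      quot≤ : ∀ {q} → d ≤ q → (N ∸ 1) quot q ≤ N quot d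
      quot≤ {suc _} d≤q = /-mono-≤ (m∸n≤m N 1) d≤q

    -- For 3-rough m, the number d m has 3-smooth part d and 3-rough part m, so each term on the
    -- left reappears on the right at n = d m.
    demand-multiples : ∀ {d} → ThreeSmooth d → 1 ≤ d →
      ∑[ m ← range (N quot d) ] 𝟙 (roughᵇ m) * demand qs N m
        ≤ ∑[ n ← range N ] 𝟙 (smoothPart n ≡ᵇ d) * demand qs N (roughPart n)
    demand-multiples {d} sd 1≤d = begin
      ∑[ m ← range (N quot d) ] 𝟙 (roughᵇ m) * demand qs N m  ≤⟨ ∑-mono (range (N quot d)) at-multiple ⟩
      ∑[ m ← range (N quot d) ] f (d * m)                     ≤⟨ ∑-range-multiples d {{>-nonZero 1≤d}} (N quot d) f ⟩
      ∑ (range (d * (N quot d))) f                            ≤⟨ ∑-range-extend f (*-quot-≤ N d) ⟩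
      ∑ (range N) f                                           ∎
      where
      open ≤-Reasoning
      f : ℕ → ℕ
      f n = 𝟙 (smoothPart n ≡ᵇ d) * demand qs N (roughPart n)
      at-multiple : ∀ m → 𝟙 (roughᵇ m) * demand qs N m ≤ f (d * m)
      at-multiple m with roughᵇ m in eq
      ... | false = z≤n
      ... | true
        rewrite smoothPart-*-rough sd (roughᵇ⇒Rough m eq) | roughPart-*-rough sd (roughᵇ⇒Rough m eq)
        with d ≡ᵇ d | ≡⇒≡ᵇ d d refl
      ...   | true | _ = ≤-refl

    -- Bound each pair, sum over `qs` to get the demand of m, and pass from m to n = d m. As `L` has
    -- no repetitions, no n is counted twice.
    lower≤demand : All ThreeSmooth L → Unique L →
      lower N ≤ ∑[ n ← range N ] demand qs N (roughPart n)
    lower≤demand smooth unique = begin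
      lower N
        ≡⟨ lower≡ N ⟩
      ∑[ d ← L ] ∑[ q ← qs ] pair N d q
        ≤⟨ ∑-mono-All (All.map (λ {d} sd → ∑-mono qs λ q → pair≤ d q (positive sd)) smooth) ⟩
      ∑[ d ← L ] ∑[ q ← qs ] ∑[ m ← range (N quot d) ] 𝟙 (roughᵇ m) * 𝟙 (q * m <ᵇ N)
        ≡⟨ ∑-cong L (λ d → trans (∑-comm qs (range (N quot d)) _) (∑-cong (range (N quot d)) λ m → ∑-*ˡ qs (𝟙 (roughᵇ m)) _)) ⟩
      ∑[ d ← L ] ∑[ m ← range (N quot d) ] 𝟙 (roughᵇ m) * demand qs N m
        ≤⟨ ∑-mono-All (All.map (λ sd → demand-multiples sd (positive sd)) smooth) ⟩
      ∑[ d ← L ] ∑[ n ← range N ] 𝟙 (smoothPart n ≡ᵇ d) * demand qs N (roughPart n)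
        ≡⟨ trans (∑-comm L (range N) _) (∑-cong (range N) λ n → ∑-*ʳ L (demand qs N (roughPart n)) _) ⟩
      ∑[ n ← range N ] (∑[ d ← L ] 𝟙 (smoothPart n ≡ᵇ d)) * demand qs N (roughPart n)
        ≤⟨ ∑-mono (range N) (λ n → *-monoˡ-≤ (demand qs N (roughPart n)) (∑-𝟙-unique (smoothPart n) unique)) ⟩
      ∑[ n ← range N ] 1 * demand qs N (roughPart n)
        ≡⟨ ∑-cong (range N) (λ n → *-identityˡ _) ⟩
      ∑[ n ← range N ] demand qs N (roughPart n) ∎
      where
      open ≤-Reasoning
      positive : ∀ {d} → ThreeSmooth d → 1 ≤ d
      positive (a , b , refl) = *-mono-≤ (m^n>0 2 a) (m^n>0 3 b)

  -- The linear estimate for large N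

  -- P is a common scale for the slopes w / (3 k); rounding them down is harmless if P is large.
  slope offset : ℕ → List (ℕ × ℕ) → ℕ
  slope P ks  = ∑[ (w , k) ← ks ] w * (P quot (3 * k))
  offset P ks = P * ∑ ks proj₁

  -- With r the count of 3-rough numbers up to N / k, N + 1 ≤ k (N / k + 1) ≤ 3 k (r + 1).
  term-linear : ∀ P N k → suc N * (proj₁ k * (P quot (3 * proj₂ k))) ≤ P * term N k + P * proj₁ k
  term-linear P N (w , zero)  = ≤-trans (≤-reflexive (trans (cong (suc N *_) (*-zeroʳ w)) (*-zeroʳ (suc N)))) z≤n
  term-linear P N (w , k@(suc _)) = begin
    suc N * (w * u)                ≤⟨ *-monoˡ-≤ (w * u) (n<[1+n/d]*d N k) ⟩
    suc (N / k) * k * (w * u)      ≤⟨ *-monoˡ-≤ (w * u) (*-monoˡ-≤ k (s≤s (rough#-linear (N / k)))) ⟩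
    suc (3 * r + 2) * k * (w * u)  ≡⟨ eq₁ r k w u ⟩
    3 * k * u * (w * (r + 1))      ≤⟨ *-monoˡ-≤ (w * (r + 1)) (*-quot-≤ P (3 * k)) ⟩
    P * (w * (r + 1))              ≡⟨ eq₂ P w r ⟩
    P * (w * r) + P * w            ∎
    where
    open ≤-Reasoning
    u r : ℕ
    u = P quot (3 * k)
    r = rough# (N / k)
    eq₁ : ∀ r k w u → suc (3 * r + 2) * k * (w * u) ≡ 3 * k * u * (w * (r + 1))
    eq₁ = solve-∀
    eq₂ : ∀ P w r → P * (w * (r + 1)) ≡ P * (w * r) + P * w
    eq₂ = solve-∀

  ∑-term-linear : ∀ P N ks → suc N * slope P ks ≤ P * ∑ ks (term N) + offset P ks
  ∑-term-linear P N ks = begin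
    suc N * slope P ks                         ≡⟨ ∑-*ˡ ks (suc N) _ ⟨
    ∑[ k ← ks ] suc N * (proj₁ k * (P quot (3 * proj₂ k))) ≤⟨ ∑-mono ks (term-linear P N) ⟩
    ∑[ k ← ks ] (P * term N k + P * proj₁ k)   ≡⟨ trans (∑-+ ks _ _) (cong₂ _+_ (∑-*ˡ ks P _) (∑-*ˡ ks P _)) ⟩
    P * ∑ ks (term N) + offset P ks            ∎
    where open ≤-Reasoning

  lower-linear : ∀ P N → 1 ≤ N →
    N * (slope P smoothWeights + slope P jumpWeights)
      ≤ P * lower N + (offset P smoothWeights + offset P jumpWeights)
  lower-linear P N@(suc M) _ = begin
    N * (s₁ + s₂)       ≡⟨ *-distribˡ-+ N s₁ s₂ ⟩
    -- The jump terms are taken at M = N - 1; the `suc` on the left of `∑-term-linear` restores N.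
    N * s₁ + N * s₂     ≤⟨ +-mono-≤ (≤-trans (*-monoˡ-≤ s₁ (n≤1+n N)) (∑-term-linear P N smoothWeights)) (∑-term-linear P M jumpWeights) ⟩
    P * t₁ + o₁ + (P * t₂ + o₂)  ≡⟨ eq P t₁ t₂ o₁ o₂ ⟩
    P * (t₁ + t₂) + (o₁ + o₂)    ∎
    where
    open ≤-Reasoning
    s₁ s₂ t₁ t₂ o₁ o₂ : ℕ
    s₁ = slope P smoothWeights
    s₂ = slope P jumpWeights
    t₁ = ∑ smoothWeights (term N)
    t₂ = ∑ jumpWeights (term M)
    o₁ = offset P smoothWeights
    o₂ = offset P jumpWeights
    eq : ∀ P x y u v → P * x + u + (P * y + v) ≡ P * (x + y) + (u + v)
    eq = solve-∀

  -- N (2 slope − 7P) > 2 offset at N = N₀, written without subtraction.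
  module _ (P N₀ : ℕ) (1≤N₀ : 1 ≤ N₀)
    (steep : 2 * (offset P smoothWeights + offset P jumpWeights) + N₀ * (7 * P)
               < N₀ * (2 * (slope P smoothWeights + slope P jumpWeights))) where

    private
      S O : ℕ
      S = slope P smoothWeights + slope P jumpWeights
      O = offset P smoothWeights + offset P jumpWeights

      7P<2S : 7 * P < 2 * S
      7P<2S = *-cancelˡ-< N₀ (7 * P) (2 * S) (≤-<-trans (m≤n+m (N₀ * (7 * P)) (2 * O)) steep)

      steep-beyond : ∀ j → 2 * O + (N₀ + j) * (7 * P) < (N₀ + j) * (2 * S)
      steep-beyond j = begin-strict
        2 * O + (N₀ + j) * (7 * P)           ≡⟨ eq O N₀ j (7 * P) ⟩
        2 * O + N₀ * (7 * P) + j * (7 * P)   <⟨ +-mono-<-≤ steep (*-monoʳ-≤ j (<⇒≤ 7P<2S)) ⟩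
        N₀ * (2 * S) + j * (2 * S)           ≡⟨ *-distribʳ-+ (2 * S) N₀ j ⟨
        (N₀ + j) * (2 * S)                   ∎
        where
        open ≤-Reasoning
        eq : ∀ o n j p → 2 * o + (n + j) * p ≡ 2 * o + n * p + j * p
        eq = solve-∀

    -- Otherwise 2 N S ≤ 2 P · `lower N` + 2 O ≤ 2 P · `supply N` + 2 O ≤ 7 P N + 2 O, against
    -- `steep-beyond`.
    supply<lower-beyond : ∀ N → N₀ ≤ N → supply N < lower N
    supply<lower-beyond N N₀≤N = ≰⇒> λ lower≤supply → <⇒≱
      (subst (λ n → 2 * O + n * (7 * P) < n * (2 * S)) (m+[n∸m]≡n N₀≤N) (steep-beyond (N ∸ N₀)))
      (begin
        N * (2 * S)                ≡⟨ swap N S ⟩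
        2 * (N * S)                ≤⟨ *-monoʳ-≤ 2 (lower-linear P N (≤-trans 1≤N₀ N₀≤N)) ⟩
        2 * (P * lower N + O)      ≤⟨ *-monoʳ-≤ 2 (+-monoˡ-≤ O (*-monoʳ-≤ P lower≤supply)) ⟩
        2 * (P * supply N + O)     ≡⟨ regroup P (supply N) O ⟩
        2 * O + P * (2 * supply N) ≤⟨ +-monoʳ-≤ (2 * O) (*-monoʳ-≤ P (supply-bound N)) ⟩
        2 * O + P * (7 * N)        ≡⟨ cong (2 * O +_) (swap₇ P N) ⟩
        2 * O + N * (7 * P)        ∎)
      where
      open ≤-Reasoning
      swap : ∀ n s → n * (2 * s) ≡ 2 * (n * s)
      swap = solve-∀
      regroup : ∀ p u o → 2 * (p * u + o) ≡ 2 * o + p * (2 * u)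
      regroup = solve-∀
      swap₇ : ∀ p n → p * (7 * n) ≡ n * (7 * p)
      swap₇ = solve-∀

-- Covering the intermediate N by intervals

-- For monotone u and l, u (A + s) < l A gives u < l on [A , A + s].  The length s grows after each success
-- and is halved after each failure; f is fuel.
module Sweep (u l : ℕ → ℕ) (N₀ : ℕ) where

  mutual
    sweep : ℕ → ℕ → ℕ → Bool
    sweep zero    A s = false
    -- `l A` is passed as an argument so that all attempts at the same A share its value.
    sweep (suc f) A s = if N₀ ≤ᵇ A then true else attempt f A s (l A)

    attempt : ℕ → ℕ → ℕ → ℕ → Bool
    attempt zero    A s y = false
    attempt (suc f) A s y =
      if u (A + s) <ᵇ y then sweep f (A + suc s) (s + s / 2 + 1) else attempt f A (s / 2) y

  module _ (u-mono : ∀ {M N} → M ≤ N → u M ≤ u N) (l-mono : ∀ {M N} → M ≤ N → l M ≤ l N) where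

    mutual
      sweep-sound : ∀ f A s → sweep f A s ≡ true → ∀ N → A ≤ N → N < N₀ → u N < l N
      sweep-sound (suc f) A s p N A≤N N<N₀ with N₀ ≤ᵇ A in eq
      ... | true  = contradiction (≤-<-trans (≤-trans (≤ᵇ⇒≤ N₀ A (subst T (sym eq) _)) A≤N) N<N₀) (<-irrefl refl)
      ... | false = attempt-sound f A s p N A≤N N<N₀

      attempt-sound : ∀ f A s → attempt f A s (l A) ≡ true → ∀ N → A ≤ N → N < N₀ → u N < l N
      attempt-sound (suc f) A s p N A≤N N<N₀ with u (A + s) <ᵇ l A in eq
      ... | false = attempt-sound f A (s / 2) p N A≤N N<N₀
      ... | true with N ≤? A + s
      ...   | yes N≤A+s = ≤-<-trans (u-mono N≤A+s) (<-≤-trans (<ᵇ⇒< _ _ (subst T (sym eq) _)) (l-mono A≤N))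
      ...   | no  N≰A+s = sweep-sound f (A + suc s) _ p N (subst (_≤ N) (sym (+-suc A s)) (≰⇒> N≰A+s)) N<N₀

-- Numerical verification for N > 26244

smooths : ℕ → List ℕ
-- Both 2^20 and 3^13 exceed 10^6, so for K ≤ 10^6 no 3-smooth number up to K is missed.
smooths K = filter (_≤? K) (cartesianProductWith (λ a b → 2 ^ a * 3 ^ b) (upTo 20) (upTo 13))

smooths-smooth : ∀ K → All ThreeSmooth (smooths K)
smooths-smooth K = filter⁺ (_≤? K)
  (cartesianProductWith⁺ (setoid ℕ) (setoid ℕ) _ (upTo 20) (upTo 13) λ {a} {b} _ _ → a , b , refl)

-- 4 M(c) ≤ 10^6 exactly for c < 35.
open LowerBound (smooths 1000000) (jumps 35)
open Sweep supply (weighted smoothWeights jumpWeights) 3500000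

-- Evaluation starts at the first N to be excluded with the one-point interval of length 0; the
-- first argument is fuel.
sweep-succeeds : sweep 1000000 26245 0 ≡ true
sweep-succeeds = refl

-- All divisors k are at most 10^6, so 10^10 / (3 k) is at least 3333 and rounding it down costs a
-- relative error below 1/3333.
steep : 2 * (offset (10 ^ 10) smoothWeights + offset (10 ^ 10) jumpWeights) + 3500000 * (7 * 10 ^ 10)
  < 3500000 * (2 * (slope (10 ^ 10) smoothWeights + slope (10 ^ 10) jumpWeights))
steep = <ᵇ⇒< _ _ _

supply<lower : ∀ N → 26244 < N → supply N < lower N
supply<lower N 26244<N with N <? 3500000
... | yes N<N₀ = sweep-sound supply-mono lower-mono 1000000 26245 0 sweep-succeeds N 26244<N N<N₀
... | no  N≮N₀ = supply<lower-beyond (10 ^ 10) 3500000 (s≤s z≤n) steep N (≮⇒≥ N≮N₀)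

not-admissible : ∀ N → N > 26244 → ¬ QuarterAdmissible N
not-admissible N N> adm = <⇒≱ (supply<lower N N>) (≤-trans
  (lower≤demand (≤-trans (s≤s z≤n) N>) (smooths-smooth 1000000) (toWitness {a? = unique? (smooths 1000000)} _))
  (demand≤supply 35 N adm))

-- An admissible choice for N = 26244

m≤n⇒^∣^ : ∀ p {m n} → m ≤ n → p ^ m ∣ p ^ n
m≤n⇒^∣^ p {m} {n} m≤n = divides (p ^ (n ∸ m)) (begin
  p ^ n               ≡⟨ cong (p ^_) (m∸n+n≡m m≤n) ⟨
  p ^ (n ∸ m + m)     ≡⟨ ^-distribˡ-+-* p (n ∸ m) m ⟩
  p ^ (n ∸ m) * p ^ m ∎)
  where open ≡-Reasoning

roughPart≥1 : ∀ n → 1 ≤ n → 1 ≤ roughPart n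
roughPart≥1 n 1≤n with factored a b m r refl ← factorization n 1≤n =
  subst (1 ≤_) (sym (Factorization.roughPart≡ {a} {b} r)) (>-nonZero⁻¹ m {{rough⇒nonZero r}})

module Witness (N : ℕ) (default : ℕ × ℕ) (candidates : List (ℕ × ℕ))
  (default-large : N ≤ 4 * (2 ^ proj₁ default * 3 ^ proj₂ default)) where

  first : List (ℕ × ℕ) → ℕ → ℕ × ℕ
  first []             m = default
  first ((a , b) ∷ cs) m = if N ≤ᵇ 4 * (2 ^ a * 3 ^ b * m) then a , b else first cs m

  first-large : ∀ cs m → 1 ≤ m → N ≤ 4 * (2 ^ proj₁ (first cs m) * 3 ^ proj₂ (first cs m) * m)
  first-large []             m 1≤m =
    ≤-trans default-large (*-monoʳ-≤ 4 (m≤m*n (2 ^ proj₁ default * 3 ^ proj₂ default) m {{>-nonZero 1≤m}}))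
  first-large ((a , b) ∷ cs) m 1≤m with N ≤ᵇ 4 * (2 ^ a * 3 ^ b * m) in eq
  ... | true  = ≤ᵇ⇒≤ N _ (subst T (sym eq) _)
  ... | false = first-large cs m 1≤m

  α β : ℕ → ℕ
  α n = proj₁ (first candidates (roughPart n))
  β n = proj₂ (first candidates (roughPart n))

  -- Both products have the form 2^x 3^y, so comparing the two sums of exponents with ν₂(N!) and
  -- ν₃(N!) is enough; the products are never evaluated.
  admissible : ∑ (range N) α ≤ legendre 2 N N → ∑ (range N) β ≤ legendre 3 N N → QuarterAdmissible N
  admissible ∑α≤ ∑β≤ =
    (λ i → 2 ^ a i * 3 ^ b i) ,
    (λ i → a i , b i , refl) ,
    subst₂ _∣_
      (sym (prodFin-smooth a b))
      (sym (trans (prodFin-cong {N} (λ i → smoothPart≡ (suc (toℕ i)))) (prodFin-smooth a′ b′)))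
      (*-pres-∣
        (m≤n⇒^∣^ 2 (subst₂ _≤_ (sym (sumFin≡∑-range N α)) (sym (trans (sumFin≡∑-range N ν₂) (∑-ν₂ N))) ∑α≤))
        (m≤n⇒^∣^ 3 (subst₂ _≤_ (sym (sumFin≡∑-range N β)) (sym (trans (sumFin≡∑-range N ν₃) (∑-ν₃ N))) ∑β≤))) ,
    λ i → first-large candidates (roughPart (suc (toℕ i))) (roughPart≥1 (suc (toℕ i)) (s≤s z≤n))
    where
    a b a′ b′ : Fin N → ℕ
    a i = α (suc (toℕ i))
    b i = β (suc (toℕ i))
    a′ i = ν₂ (suc (toℕ i))
    b′ i = ν₃ (suc (toℕ i))

-- Each candidate is a cheapest 3-smooth number in [x , ∞) for some x; 48 = 2^4 · 3 and 72 = 2^3 · 3^2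
-- are left out, so that 54 and 81 take their place, to balance the powers of 2 against those of 3.
candidates : List (ℕ × ℕ)
candidates =
  (0 , 0) ∷ (1 , 0) ∷ (0 , 1) ∷ (2 , 0) ∷ (1 , 1) ∷ (3 , 0) ∷ (0 , 2) ∷ (2 , 1) ∷
  (4 , 0) ∷ (1 , 2) ∷ (3 , 1) ∷ (0 , 3) ∷ (5 , 0) ∷ (2 , 2) ∷ (1 , 3) ∷ (6 , 0) ∷
  (0 , 4) ∷ (5 , 1) ∷ (2 , 3) ∷ (7 , 0) ∷ (4 , 2) ∷ (1 , 4) ∷ (6 , 1) ∷ (3 , 3) ∷
  (0 , 5) ∷ (5 , 2) ∷ (7 , 1) ∷ (4 , 3) ∷ (9 , 0) ∷ (3 , 4) ∷ (2 , 5) ∷ (1 , 6) ∷ []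

-- Since 4 · 3^8 = 26244, the default reaches N/4 exactly at m = 1. For every m ≥ 5 the last
-- candidate 2 · 3^6 = 1458 is already large enough.
open Witness 26244 (0 , 8) candidates ≤-refl

admissible-26244 : QuarterAdmissible 26244
admissible-26244 = admissible (≤ᵇ⇒≤ _ _ _) (≤ᵇ⇒≤ _ _ _)

theorem1p3 : QuarterAdmissible 26244 × (∀ N → N > 26244 → ¬ QuarterAdmissible N)
theorem1p3 = admissible-26244 , not-admissible
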